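{- Let $(G,\gamma)$ be an edge-colored graph with $n$ vertices, $m$ edges, and $\ell\geq 2$ colors. Suppose that $s>0$ of the colors are each used exactly once in the graph, while each of the other $\ell-s$ colors is used exactly twice. If $n-2>\ell-s$, then $\operatorname{wld}(G)=n-1$.
   Context: An edge-colored graph $(G,\gamma)$ is a finite connected graph $G$ with a surjective function $\gamma:E(G)\to\mathcal{C}=\{c_1,\dots,c_\ell\}$ onto a finite set of colors (not necessarily a proper edge-coloring). For each color $c_i$ let $E_i(G)=\{e\in E(G):\gamma(e)=c_i\}$; the color $c_i$ is used exactly $t$ times if $|E_i(G)|=t$. For $W\subseteq E(G)$, let $G_i^W$ be the graph with vertex set $V(G)$ and edge set $W\cup E_i(G)$. The set $W$ is color-connecting if $G_i^W$ is connected for every color $c_i\in\mathcal{C}$. The wild number $\operatorname{wld}(G)$ is the minimum size of a color-connecting set. -}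

module Defs where

open import Data.Fin using (Fin; _≟_)
open import Data.Fin.Subset using (Subset; _∈_; _∪_; ∣_∣; ⊤)
open import Data.Nat using (ℕ; _≤_)
open import Data.Product using (_×_; _,_; ∃-syntax)
open import Data.Vec using (tabulate)
open import Function.Definitions using (Surjective)
open import Relation.Binary.Construct.Closure.Equivalence using (EqClosure)
open import Relation.Binary.PropositionalEquality using (_≡_)
open import Relation.Nullary using (does)

-- Graphs with vertex set Fin n and edge set Fin m.  Loops and parallel edges
-- are allowed; simple graphs are the instances without them.  The order of the
-- two endpoints of an edge carries no meaning: Connected is defined through a
-- symmetric closure.
record Graph (n m : ℕ) : Set where
  field
    endpoints : Fin m → Fin n × Fin n

module _ {n m : ℕ} (G : Graph n m) where
  open Graph G

  Link : Subset m → Fin n → Fin n → Set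
  Link F u v = ∃[ e ] (e ∈ F × endpoints e ≡ (u , v))

  -- Connectedness of the graph with vertex set Fin n and edge set F: a proof of
  -- EqClosure (Link F) u v is exactly a walk from u to v along edges of F.
  Connected : Subset m → Set
  Connected F = (u v : Fin n) → EqClosure (Link F) u v

record EdgeColoredGraph (n m ℓ : ℕ) : Set where
  field
    graph      : Graph n m
    connected  : Connected graph ⊤
    color      : Fin m → Fin ℓ
    surjective : Surjective _≡_ _≡_ color

module _ {n m ℓ : ℕ} (G : EdgeColoredGraph n m ℓ) where
  open EdgeColoredGraph G

  colorClass : Fin ℓ → Subset m
  colorClass c = tabulate (λ e → does (color e ≟ c))

  UsedExactly : ℕ → Fin ℓ → Set
  UsedExactly t c = ∣ colorClass c ∣ ≡ t

  ColorConnecting : Subset m → Set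
  ColorConnecting W = (c : Fin ℓ) → Connected graph (W ∪ colorClass c)

  -- wld(G) = k.  The minimum is over a nonempty family, since the set of all
  -- edges is color-connecting, and its value is unique by antisymmetry of ≤.
  record WildNumber (k : ℕ) : Set where
    field
      attained : ∃[ W ] (ColorConnecting W × ∣ W ∣ ≡ k)
      minimal  : (W : Subset m) → ColorConnecting W → k ≤ ∣ W ∣

{-# OPTIONS --safe #-}
-- A spanning tree of G is color-connecting, so wld(G) ≤ n − 1.  Conversely, let
-- W be color-connecting with |W| < n − 1.  Then W is not connected, so no color
-- class lies inside W: a color used once has no edge in W, and a color used
-- twice has at most one.  Hence the coloring maps W injectively into the colors
-- used twice, and |W| ≤ ℓ − s < n − 2.  But W becomes connected after adding the
-- single edge of some color used once, so |W| + 1 ≥ n − 1.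
module Submission where

open import Defs
open import Data.Fin using (Fin; zero; suc; _≟_; punchIn; punchOut)
open import Data.Fin.Properties
  using (punchInᵢ≢i; punchOut-punchIn; punchOut-cong; punchOut-injective; suc-injective)
open import Data.Fin.Subset
  using (Subset; _∈_; _∉_; _⊆_; _∪_; _-_; ∁; ∣_∣; inside; outside; ⊤; Nonempty)
open import Data.Fin.Subset.Properties
  using (∣⊥∣≡0; nonempty?; Empty-unique; x∈p⇒∣p-x∣<∣p∣; x∈p∧x≢y⇒x∈p-y; ∣∁p∣≡n∸∣p∣;
         x∉p⇒x∈∁p; p⊆q⇒∣p∣≤∣q∣; p⊆p∪q; s⊆s; out⊆; x∈p∪q⁻)
open import Data.Nat using (ℕ; zero; suc; _+_; _∸_; _≤_; _≥_; _>_; z≤n; s≤s; s≤s⁻¹)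
open import Data.Nat.Properties
  using (≤-trans; ≤-reflexive; m≤n⇒m≤1+n; +-suc; +-comm; _≤?_; n≮n; module ≤-Reasoning)
open import Data.Product using (_×_; _,_; proj₁; proj₂; ∃-syntax)
open import Data.Sum using (inj₁; inj₂)
open import Data.Vec using ([]; _∷_; here; there)
open import Data.Vec.Properties using ([]=⇒lookup; lookup⇒[]=; lookup∘tabulate)
open import Function using (_∘_; id)
open import Function.Definitions using (StrictlySurjective)
open import Relation.Binary.Construct.Closure.Equivalence
  using (EqClosure; reflexive; symmetric; transitive; gmap; gfold)
open import Relation.Binary.Construct.Closure.ReflexiveTransitive using (return)
open import Relation.Binary.Construct.Closure.Symmetric using (fwd)
open import Relation.Binary.PropositionalEquality
  using (_≡_; _≢_; refl; sym; trans; cong; subst; isEquivalence)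
open import Relation.Nullary using (¬_; yes; no; contradiction)
open import Relation.Nullary.Decidable using (decidable-stable; dec-true)

private
  variable
    k m n ℓ : ℕ

-- Cardinalities of finite subsets.

∣p∪q∣≤∣p∣+∣q∣ : (p q : Subset n) → ∣ p ∪ q ∣ ≤ ∣ p ∣ + ∣ q ∣
∣p∪q∣≤∣p∣+∣q∣ []            []            = z≤n
∣p∪q∣≤∣p∣+∣q∣ (outside ∷ p) (outside ∷ q) = ∣p∪q∣≤∣p∣+∣q∣ p q
∣p∪q∣≤∣p∣+∣q∣ (outside ∷ p) (inside ∷ q)
  rewrite +-suc ∣ p ∣ ∣ q ∣ = s≤s (∣p∪q∣≤∣p∣+∣q∣ p q)
∣p∪q∣≤∣p∣+∣q∣ (inside ∷ p)  (outside ∷ q) = s≤s (∣p∪q∣≤∣p∣+∣q∣ p q)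
∣p∪q∣≤∣p∣+∣q∣ (inside ∷ p)  (inside ∷ q)
  rewrite +-suc ∣ p ∣ ∣ q ∣ = s≤s (m≤n⇒m≤1+n (∣p∪q∣≤∣p∣+∣q∣ p q))

∣p∣>0⇒Nonempty : (p : Subset n) → ∣ p ∣ > 0 → Nonempty p
∣p∣>0⇒Nonempty {n} p ∣p∣>0 with nonempty? p
... | yes nonempty = nonempty
... | no  empty
  rewrite Empty-unique empty | ∣⊥∣≡0 n = contradiction ∣p∣>0 λ ()

∣p∣≤1⇒x≡y : (p : Subset n) → ∣ p ∣ ≤ 1 → ∀ {x y} → x ∈ p → y ∈ p → x ≡ y
∣p∣≤1⇒x≡y p ∣p∣≤1 {x} {y} x∈p y∈p = decidable-stable (x ≟ y) λ x≢y →
  let y∈p-x = x∈p∧x≢y⇒x∈p-y y∈p (x≢y ∘ sym)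
      ∣p-x∣<1 = ≤-trans (x∈p⇒∣p-x∣<∣p∣ x∈p) ∣p∣≤1
  in contradiction (≤-trans (x∈p⇒∣p-x∣<∣p∣ y∈p-x) (s≤s⁻¹ ∣p-x∣<1)) λ ()

∣p∣≤2⇒y≡z : (p : Subset n) → ∣ p ∣ ≤ 2 → ∀ {x y z} → x ∈ p → y ∈ p → z ∈ p →
            y ≢ x → z ≢ x → y ≡ z
∣p∣≤2⇒y≡z p ∣p∣≤2 {x} x∈p y∈p z∈p y≢x z≢x =
  ∣p∣≤1⇒x≡y (p - x) (s≤s⁻¹ (≤-trans (x∈p⇒∣p-x∣<∣p∣ x∈p) ∣p∣≤2))
    (x∈p∧x≢y⇒x∈p-y y∈p y≢x) (x∈p∧x≢y⇒x∈p-y z∈p z≢x)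

-- Induction on `p`: when the first element lies in `p`, its image is deleted from `q`, and
-- injectivity keeps all other images in what remains.
injectiveOn⇒∣p∣≤∣q∣ : (f : Fin m → Fin ℓ) (p : Subset m) (q : Subset ℓ) →
                     (∀ {x} → x ∈ p → f x ∈ q) →
                     (∀ {x y} → x ∈ p → y ∈ p → f x ≡ f y → x ≡ y) →
                     ∣ p ∣ ≤ ∣ q ∣
injectiveOn⇒∣p∣≤∣q∣ f []            q maps inj = z≤n
injectiveOn⇒∣p∣≤∣q∣ f (outside ∷ p) q maps inj =
  injectiveOn⇒∣p∣≤∣q∣ (f ∘ suc) p q (maps ∘ there)
    λ x∈p y∈p → suc-injective ∘ inj (there x∈p) (there y∈p)
injectiveOn⇒∣p∣≤∣q∣ f (inside ∷ p)  q maps inj =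
  ≤-trans
    (s≤s (injectiveOn⇒∣p∣≤∣q∣ (f ∘ suc) p (q - f zero)
      (λ x∈p → x∈p∧x≢y⇒x∈p-y (maps (there x∈p))
                 λ eq → contradiction (inj (there x∈p) here eq) λ ())
      λ x∈p y∈p → suc-injective ∘ inj (there x∈p) (there y∈p)))
    (x∈p⇒∣p-x∣<∣p∣ (maps here))

-- Spanning forests and spanning trees.

Link-mono : (G : Graph n m) {E F : Subset m} → E ⊆ F →
            ∀ {u v} → Link G E u v → Link G F u v
Link-mono G E⊆F (e , e∈E , eq) = e , E⊆F e∈E , eq

Connected-mono : (G : Graph n m) {E F : Subset m} → E ⊆ F → Connected G E → Connected G F
Connected-mono G E⊆F conn u v = gmap id (Link-mono G E⊆F) (conn u v)

-- The labels are the components of F.  That they are also the components of the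
-- subset `edges`, and that |edges| plus their number is n, makes `edges` a
-- spanning forest of F.
record SpanningForest (G : Graph n m) (F : Subset m) : Set where
  field
    edges       : Subset m
    edges⊆F     : edges ⊆ F
    components  : ℕ
    count       : ∣ edges ∣ + components ≡ n
    label       : Fin n → Fin components
    surjective  : StrictlySurjective _≡_ label
    linked      : ∀ {u v} → Link G F u v → label u ≡ label v
    connects    : ∀ {u v} → label u ≡ label v → EqClosure (Link G edges) u v

Fin⇒suc : Fin k → ∃[ j ] k ≡ suc j
Fin⇒suc {suc k} _ = k , refl

module Merge {k : ℕ} (a b : Fin (suc k)) (a≢b : a ≢ b) where

  redirect : Fin (suc k) → Fin (suc k)
  redirect x with x ≟ b
  ... | yes _ = a
  ... | no  _ = x

  redirect-b : redirect b ≡ a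
  redirect-b with b ≟ b
  ... | yes _   = refl
  ... | no  b≢b = contradiction refl b≢b

  redirect-≢ : ∀ {x} → x ≢ b → redirect x ≡ x
  redirect-≢ {x} x≢b with x ≟ b
  ... | yes x≡b = contradiction x≡b x≢b
  ... | no  _   = refl

  b≢redirect : ∀ x → b ≢ redirect x
  b≢redirect x with x ≟ b
  ... | yes _   = a≢b ∘ sym
  ... | no  x≢b = x≢b ∘ sym

  merge : Fin (suc k) → Fin k
  merge x = punchOut (b≢redirect x)

  merge-identifies : merge a ≡ merge b
  merge-identifies = punchOut-cong b (trans (redirect-≢ a≢b) (sym redirect-b))

  merge⇒redirect : ∀ x y → merge x ≡ merge y → redirect x ≡ redirect y
  merge⇒redirect x y = punchOut-injective (b≢redirect x) (b≢redirect y)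

  merge-punchIn : ∀ j → merge (punchIn b j) ≡ j
  merge-punchIn j =
    trans (punchOut-cong b (redirect-≢ (punchInᵢ≢i b j))) (punchOut-punchIn b)

module _ (G : Graph n (suc m)) where
  open Graph G

  tailGraph : Graph n m
  tailGraph = record { endpoints = endpoints ∘ suc }

  private
    u₀ = proj₁ (endpoints zero)
    v₀ = proj₂ (endpoints zero)

  Link-there : ∀ {s F u v} → Link tailGraph F u v → Link G (s ∷ F) u v
  Link-there (e , e∈F , eq) = suc e , there e∈F , eq

  -- Serves two cases: the first edge is absent from the set, or it is present with both ends
  -- already in one component. Only the second has to supply an equality of labels.
  skipEdge : ∀ {s F} (T : SpanningForest tailGraph F) →
             (s ≡ inside → SpanningForest.label T u₀ ≡ SpanningForest.label T v₀) →
             SpanningForest G (s ∷ F)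
  skipEdge {s} {F} T s⇒u₀≡v₀ = record
    { edges      = outside ∷ edges
    ; edges⊆F    = out⊆ edges⊆F
    ; components = components
    ; count      = count
    ; label      = label
    ; surjective = surjective
    ; linked     = linked′
    ; connects   = gmap id Link-there ∘ connects
    }
    where
    open SpanningForest T
    linked′ : ∀ {u v} → Link G (s ∷ F) u v → label u ≡ label v
    linked′ (zero  , here      , refl) = s⇒u₀≡v₀ refl
    linked′ (suc e , there e∈F , eq)   = linked (e , e∈F , eq)

  -- The new edge enters the forest and fuses two components, which preserves the sum in `count`.
  -- The number of components is given by an equation, so that `refl` can replace it by `suc k` once
  -- the record pattern has made it a variable.
  joinEdge : ∀ {F k} (T : SpanningForest tailGraph F) →
             SpanningForest.components T ≡ suc k →
             SpanningForest.label T u₀ ≢ SpanningForest.label T v₀ →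
             SpanningForest G (inside ∷ F)
  joinEdge {F} {k} record
    { edges = edges ; edges⊆F = edges⊆F ; count = count ; label = label
    ; surjective = surjective ; linked = linked ; connects = connects } refl u₀≢v₀ = record
    { edges      = inside ∷ edges
    ; edges⊆F    = s⊆s edges⊆F
    ; components = k
    ; count      = trans (sym (+-suc ∣ edges ∣ k)) count
    ; label      = merge ∘ label
    ; surjective = λ j → let (u , eq) = surjective (punchIn (label v₀) j)
                         in u , trans (cong merge eq) (merge-punchIn j)
    ; linked     = linked′
    ; connects   = connects′
    }
    where
    open Merge (label u₀) (label v₀) u₀≢v₀

    _~_ = EqClosure (Link G (inside ∷ edges))

    linked′ : ∀ {u v} → Link G (inside ∷ F) u v → merge (label u) ≡ merge (label v)
    linked′ (zero  , here      , refl) = merge-identifies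
    linked′ (suc e , there e∈F , eq)   = cong merge (linked (e , e∈F , eq))

    connectsThere : ∀ {u v} → label u ≡ label v → u ~ v
    connectsThere = gmap id Link-there ∘ connects

    -- Only vertices labelled like `v₀` have to move: they walk to `v₀` along old forest edges and
    -- cross the new edge backwards to `u₀`.
    representative : ∀ w → ∃[ w′ ] (label w′ ≡ redirect (label w) × w ~ w′)
    representative w with label w ≟ label v₀
    ... | yes eq = u₀ , refl , transitive _ (connectsThere eq)
                                 (symmetric _ (return (fwd (zero , here , refl))))
    ... | no  _  = w , refl , reflexive _

    connects′ : ∀ {u v} → merge (label u) ≡ merge (label v) → u ~ v
    connects′ {u} {v} eq =
      let (u′ , lu , u~u′) = representative u
          (v′ , lv , v~v′) = representative v
      in transitive _ u~u′ (transitive _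
           (connectsThere (trans lu (trans (merge⇒redirect (label u) (label v) eq) (sym lv))))
           (symmetric _ v~v′))

  addEdge : ∀ {F} → SpanningForest tailGraph F → SpanningForest G (inside ∷ F)
  addEdge T with SpanningForest.label T u₀ ≟ SpanningForest.label T v₀
  ... | yes eq = skipEdge T λ _ → eq
  -- The label of `u₀` inhabits `Fin components`, so the number of components is a successor.
  ... | no  ne = joinEdge T (proj₂ (Fin⇒suc (SpanningForest.label T u₀))) ne

-- Kruskal's algorithm, from the last edge to the first: every vertex starts as its own component,
-- and an edge of `F` is kept exactly when its ends carry different labels.
spanningForest : (G : Graph n m) (F : Subset m) → SpanningForest G F
spanningForest {n} G [] = record
  { edges      = []
  ; edges⊆F    = id
  ; components = n
  ; count      = refl
  ; label      = id
  ; surjective = λ j → j , refl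
  ; linked     = λ ()
  ; connects   = λ { refl → reflexive _ }
  }
spanningForest G (outside ∷ F) = skipEdge G (spanningForest (tailGraph G) F) λ ()
spanningForest G (inside ∷ F) = addEdge G (spanningForest (tailGraph G) F)

-- The nonempty domain excludes `k = 0`; for `k ≥ 2` two distinct values would be attained.
surjectiveConstant⇒k≡1 : (f : Fin (suc n) → Fin k) → StrictlySurjective _≡_ f →
                         (∀ u v → f u ≡ f v) → k ≡ 1
surjectiveConstant⇒k≡1 {k = zero}        f surj const = contradiction (f zero) λ ()
surjectiveConstant⇒k≡1 {k = suc zero}    f surj const = refl
surjectiveConstant⇒k≡1 {k = suc (suc k)} f surj const =
  let (u , fu≡0) = surj zero
      (v , fv≡1) = surj (suc zero)
  in contradiction (trans (sym fu≡0) (trans (const u v) fv≡1)) λ ()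

spanningTree : (G : Graph (suc n) m) (F : Subset m) → Connected G F →
               ∃[ W ] (W ⊆ F × Connected G W × ∣ W ∣ ≡ n)
spanningTree {n} G F conn =
  edges , edges⊆F , (λ u v → connects (sameLabel u v)) , size
  where
  open SpanningForest (spanningForest G F)

  sameLabel : ∀ u v → label u ≡ label v
  -- Equality of labels is an equivalence relation that holds along links, hence along walks.
  sameLabel u v = gfold isEquivalence label linked (conn u v)

  size : ∣ edges ∣ ≡ n
  size = cong (_∸ 1) (trans (+-comm 1 ∣ edges ∣)
    (subst (λ k → ∣ edges ∣ + k ≡ suc n)
      (surjectiveConstant⇒k≡1 label surjective sameLabel) count))

Connected⇒n∸1≤∣F∣ : (G : Graph n m) (F : Subset m) → Connected G F → n ∸ 1 ≤ ∣ F ∣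
Connected⇒n∸1≤∣F∣ {zero}  G F conn = z≤n
Connected⇒n∸1≤∣F∣ {suc n} G F conn =
  let (W , W⊆F , _ , ∣W∣≡n) = spanningTree G F conn
  in subst (_≤ ∣ F ∣) ∣W∣≡n (p⊆q⇒∣p∣≤∣q∣ W⊆F)

-- Color-connecting sets and color classes.

module _ (G : EdgeColoredGraph n m ℓ) where
  open EdgeColoredGraph G

  ∈colorClass⁺ : ∀ {e c} → color e ≡ c → e ∈ colorClass G c
  ∈colorClass⁺ {e} {c} eq = lookup⇒[]= e _
    (trans (lookup∘tabulate _ e) (dec-true (color e ≟ c) eq))

  ∈colorClass⁻ : ∀ {e c} → e ∈ colorClass G c → color e ≡ c
  ∈colorClass⁻ {e} {c} e∈ with color e ≟ c | trans (sym (lookup∘tabulate _ e)) ([]=⇒lookup e∈)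
  ... | yes eq | _  = eq
  ... | no  _  | ()

  module _ {W : Subset m} (W-cc : ColorConnecting G W) where

    -- Applied in contrapositive form: a disconnected color-connecting set contains no whole color
    -- class.
    colorClass⊆⇒Connected : ∀ {c} → colorClass G c ⊆ W → Connected graph W
    colorClass⊆⇒Connected {c} class⊆W = Connected-mono graph W∪class⊆W (W-cc c)
      where
      W∪class⊆W : W ∪ colorClass G c ⊆ W
      W∪class⊆W e∈ with x∈p∪q⁻ W (colorClass G c) e∈
      ... | inj₁ e∈W = e∈W
      ... | inj₂ e∈c = class⊆W e∈c

    usedOnce⇒∉ : ¬ Connected graph W → ∀ {e} → UsedExactly G 1 (color e) → e ∉ W
    usedOnce⇒∉ ¬conn {e} once e∈W = ¬conn (colorClass⊆⇒Connected class⊆W)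
      where
      class⊆W : colorClass G (color e) ⊆ W
      class⊆W x∈c =
        subst (_∈ W) (∣p∣≤1⇒x≡y _ (≤-reflexive once) (∈colorClass⁺ refl) x∈c) e∈W

    -- If `e` and `f` were distinct, they would exhaust their color class, which would then lie
    -- inside `W`.
    usedTwice⇒injective : ¬ Connected graph W → ∀ {e f} → UsedExactly G 2 (color e) →
                          e ∈ W → f ∈ W → color e ≡ color f → e ≡ f
    usedTwice⇒injective ¬conn {e} {f} twice e∈W f∈W eq =
      decidable-stable (e ≟ f) λ e≢f → ¬conn (colorClass⊆⇒Connected (class⊆W e≢f))
      where
      class⊆W : e ≢ f → colorClass G (color e) ⊆ W
      class⊆W e≢f {x} x∈c with x ≟ e
      ... | yes refl = e∈W
      ... | no  x≢e  = subst (_∈ W)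
        (∣p∣≤2⇒y≡z _ (≤-reflexive twice) (∈colorClass⁺ refl) (∈colorClass⁺ (sym eq)) x∈c
          (e≢f ∘ sym) x≢e)
        f∈W

    n∸2≤∣W∣ : ∀ {c} → UsedExactly G 1 c → n ∸ 2 ≤ ∣ W ∣
    n∸2≤∣W∣ {c} once = n∸1≤1+k⇒n∸2≤k n (begin
      n ∸ 1                       ≤⟨ Connected⇒n∸1≤∣F∣ graph (W ∪ colorClass G c) (W-cc c) ⟩
      ∣ W ∪ colorClass G c ∣      ≤⟨ ∣p∪q∣≤∣p∣+∣q∣ W (colorClass G c) ⟩
      ∣ W ∣ + ∣ colorClass G c ∣  ≡⟨ cong (∣ W ∣ +_) once ⟩
      ∣ W ∣ + 1                   ≡⟨ +-comm ∣ W ∣ 1 ⟩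
      suc ∣ W ∣                   ∎)
      where
      open ≤-Reasoning
      n∸1≤1+k⇒n∸2≤k : ∀ n {k} → n ∸ 1 ≤ suc k → n ∸ 2 ≤ k
      n∸1≤1+k⇒n∸2≤k zero          _  = z≤n
      n∸1≤1+k⇒n∸2≤k (suc zero)    _  = z≤n
      n∸1≤1+k⇒n∸2≤k (suc (suc n)) le = s≤s⁻¹ le

    -- The edges of `W` are counted by their colors, which are pairwise distinct and avoid `S`.
    disconnected⇒∣W∣≤∣∁S∣ : ¬ Connected graph W → (S : Subset ℓ) →
                            (∀ c → c ∈ S → UsedExactly G 1 c) →
                            (∀ c → c ∉ S → UsedExactly G 2 c) →
                            ∣ W ∣ ≤ ∣ ∁ S ∣
    disconnected⇒∣W∣≤∣∁S∣ ¬conn S once twice =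
      injectiveOn⇒∣p∣≤∣q∣ color W (∁ S) (x∉p⇒x∈∁p ∘ color∉S)
        λ e∈W → usedTwice⇒injective ¬conn (twice _ (color∉S e∈W)) e∈W
      where
      color∉S : ∀ {e} → e ∈ W → color e ∉ S
      color∉S e∈W c∈S = usedOnce⇒∉ ¬conn (once _ c∈S) e∈W

corollary6p3 : (n m ℓ s : ℕ) (G : EdgeColoredGraph n m ℓ) →
    ℓ ≥ 2 →
    s > 0 →
    (S : Subset ℓ) → ∣ S ∣ ≡ s →
    ((c : Fin ℓ) → c ∈ S → UsedExactly G 1 c) →
    ((c : Fin ℓ) → c ∉ S → UsedExactly G 2 c) →
    n ∸ 2 > ℓ ∸ s →
    WildNumber G (n ∸ 1)
-- With no vertices the last hypothesis would read `0 > ℓ ∸ s`, so only `suc n` remains; from here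
-- on `n` is one less than the number of vertices.
corollary6p3 (suc n) m ℓ s G _ s>0 S refl once twice n∸2>ℓ∸s = record
  { attained =
      let (W , _ , conn , size) = spanningTree graph ⊤ connected
      in W , (λ c → Connected-mono graph (p⊆p∪q (colorClass G c)) conn) , size
  ; minimal = minimal
  }
  where
  open EdgeColoredGraph G

  minimal : (W : Subset m) → ColorConnecting G W → n ≤ ∣ W ∣
  -- Assuming `∣ W ∣ < n` makes `W` disconnected, and the two bounds on `∣ W ∣` then clash.
  minimal W W-cc = decidable-stable (n ≤? ∣ W ∣) λ n≰∣W∣ →
    let (c , c∈S) = ∣p∣>0⇒Nonempty S s>0
    in n≮n ∣ W ∣ (begin-strict
      ∣ W ∣      ≤⟨ disconnected⇒∣W∣≤∣∁S∣ G W-cc (n≰∣W∣ ∘ Connected⇒n∸1≤∣F∣ graph W) S once twice ⟩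
      ∣ ∁ S ∣    ≡⟨ ∣∁p∣≡n∸∣p∣ S ⟩
      ℓ ∸ ∣ S ∣  <⟨ n∸2>ℓ∸s ⟩
      suc n ∸ 2  ≤⟨ n∸2≤∣W∣ G W-cc (once c c∈S) ⟩
      ∣ W ∣      ∎)
    where open ≤-Reasoning
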